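{- Let $\mathbf{F}_q$ be the finite field with $q$ elements. Let $P_3(x_1,x_2,x_3)$ and $Q_3(x_1,x_2,x_3)$ be homogeneous polynomials of degree $3$ and $Q_4(x_1,x_2,x_3)$ a homogeneous polynomial of degree $4$ (standard grading), with coefficients in $\mathbf{F}_q$, not all three zero. Let $\widetilde X_5^{(3)}\subset \mathbf{P}_{\widetilde\Sigma_L}$ be the RC-quintic $3$-fold over $\mathbf{F}_q$ with equation $$x_0^2P_3(x_1,x_2,x_3)+x_0x_4Q_3(x_1,x_2,x_3)+x_4x_5Q_4(x_1,x_2,x_3)=0 .$$ Then $$\sharp\,\widetilde X_5^{(3)}(\mathbf{F}_q)\equiv 1 \pmod q .$$
   Context: For a field $K$, $\mathbf{P}_{\widetilde\Sigma_L}$ denotes the blow-up of $\mathbf{P}^4_K$ along the line $L=\{x_1=x_2=x_3=0\}$, realized as the toric variety $(\mathbf{A}^6\setminus Z)/\mathbf{G}_m^2$, where $\mathbf{A}^6$ has coordinates $(x_0,\dots,x_5)$, the exceptional set is $$Z=\{x_1=x_2=x_3=0\}\cup\{x_0=x_4=x_5=0\},$$ and $\mathbf{G}_m^2$ acts by $(\lambda,\mu)\cdot(x_0,\dots,x_5)=(\lambda\mu x_0,\lambda x_1,\lambda x_2,\lambda x_3,\lambda\mu x_4,\mu x_5)$. Its $K$-points are the classes of points of $K^6\setminus Z(K)$ modulo $(K^*)^2$. The blow-up map to $\mathbf{P}^4$ is $[x_0,\dots,x_5]\mapsto[x_0,x_5x_1,x_5x_2,x_5x_3,x_4]$. The polynomial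 in the equation is bihomogeneous of bidegree $(5,2)$ for the grading $\deg x_1=\deg x_2=\deg x_3=(1,0)$, $\deg x_5=(0,1)$, $\deg x_0=\deg x_4=(1,1)$, so its vanishing is well defined on $\mathbf{P}_{\widetilde\Sigma_L}$; $\widetilde X_5^{(3)}(\mathbf{F}_q)$ is the set of $\mathbf{F}_q$-points of $\mathbf{P}_{\widetilde\Sigma_L}$ where it vanishes. "RC-quintic $3$-fold" is the name for such a hypersurface: it is the strict transform under the blow-up of the quintic $x_0^2P_3+x_0x_4Q_3+x_4Q_4=0$ in $\mathbf{P}^4$, which contains $L$ with multiplicity $3$. No smoothness is assumed. -}

module Defs where

open import Level using (Level; _⊔_)
open import Algebra.Apartness.Bundles using (HeytingCommutativeRing; HeytingField)
open import Algebra.Bundles using (CommutativeRing; Semiring)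
open import Data.Bool.Base using (if_then_else_)
open import Data.Fin.Base using (Fin)
open import Data.Fin.Patterns using (0F; 1F; 2F; 3F; 4F; 5F)
open import Data.Integer.Base using (+_; _-_)
open import Data.Integer.Divisibility using (_∣_)
open import Data.List.Base using (List; []; _∷_)
open import Data.Nat.Base using (ℕ)
import Data.Nat.Properties as ℕ
open import Data.Product.Base using (_×_; _,_; proj₁; proj₂; Σ-syntax; ∃-syntax)
open import Data.Sum.Base using (_⊎_)
open import Data.Vec.Base as Vec using (Vec)
import Data.Vec.Functional as Vector
open import Data.Vec.Functional using (Vector)
import Data.Vec.Properties as Vec
open import Function.Bundles using (Inverse)
open import Relation.Binary.Bundles using (Setoid)
import Relation.Binary.Construct.On as On
open import Relation.Binary.PropositionalEquality as ≡ using (_≡_)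
open import Relation.Nullary.Decidable.Core using (does)
open import Relation.Nullary.Negation.Core using (¬_)

HasCardinality : ∀ {a ℓ} → Setoid a ℓ → ℕ → Set (a ⊔ ℓ)
HasCardinality S n = Inverse S (≡.setoid (Fin n))

infix 4 _≡_mod_

_≡_mod_ : ℕ → ℕ → ℕ → Set
a ≡ b mod n = + n ∣ + a - + b

-- A Heyting field whose setoid is in bijection with some Fin q has decidable
-- equality, and its apartness is then x ≉ y: it is a finite field in the
-- usual sense, and conversely every finite field arises in this way.

module OverField {c ℓ₁ ℓ₂ : Level} (K : HeytingField c ℓ₁ ℓ₂) where

  commutativeRing : CommutativeRing c ℓ₁
  commutativeRing =
    HeytingCommutativeRing.commutativeRing (HeytingField.heytingCommutativeRing K)

  open CommutativeRing commutativeRing hiding (_-_)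
  open import Algebra.Definitions _≈_ using (Invertible)
  open import Algebra.Definitions.RawSemiring (Semiring.rawSemiring semiring) using (_^_; product)
  open import Data.Vec.Functional.Relation.Binary.Equality.Setoid setoid using (_≋_)
  open import Relation.Binary.Reasoning.Setoid setoid

  fieldSetoid : Setoid c ℓ₁
  fieldSetoid = setoid

  -- A finite formal sum of terms a · x^e, given by pairs (a , e).  Different
  -- lists may denote the same polynomial (terms are not collected), so the
  -- notions below that concern the polynomial itself go through `coeff`.

  Polynomial : ℕ → Set c
  Polynomial n = List (Carrier × Vec ℕ n)

  coeff : ∀ {n} → Polynomial n → Vec ℕ n → Carrier
  coeff []            m = 0#
  coeff ((a , e) ∷ p) m =
    (if does (Vec.≡-dec ℕ._≟_ e m) then a else 0#) + coeff p m

  IsZero : ∀ {n} → Polynomial n → Set ℓ₁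
  IsZero p = ∀ m → coeff p m ≈ 0#

  -- As usual, the zero polynomial is homogeneous of every degree.

  IsHomogeneous : ∀ {n} → ℕ → Polynomial n → Set ℓ₁
  IsHomogeneous d p = ∀ m → ¬ (coeff p m ≈ 0#) → Vec.sum m ≡ d

  eval : ∀ {n} → Polynomial n → Vector Carrier n → Carrier
  eval []            x = 0#
  eval ((a , e) ∷ p) x = a * product (λ i → x i ^ Vec.lookup e i) + eval p x

  𝔾ₘ : Set (c ⊔ ℓ₁)
  𝔾ₘ = Σ[ u ∈ Carrier ] Invertible 1# _*_ u

  𝔸⁶ : Set c
  𝔸⁶ = Vector Carrier 6

  Z : 𝔸⁶ → Set ℓ₁
  Z x = (x 1F ≈ 0# × x 2F ≈ 0# × x 3F ≈ 0#)
      ⊎ (x 0F ≈ 0# × x 4F ≈ 0# × x 5F ≈ 0#)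

  weight : Carrier → Carrier → 𝔸⁶
  weight l m 0F = l * m
  weight l m 1F = l
  weight l m 2F = l
  weight l m 3F = l
  weight l m 4F = l * m
  weight l m 5F = m

  infixr 7 _·_

  _·_ : 𝔾ₘ × 𝔾ₘ → 𝔸⁶ → 𝔸⁶
  (((l , _) , (m , _)) · x) i = weight l m i * x i

  infix 4 _∼_

  _∼_ : 𝔸⁶ → 𝔸⁶ → Set (c ⊔ ℓ₁)
  x ∼ y = ∃[ g ] g · x ≋ y

  weight-cong : ∀ {l l′ m m′} → l ≈ l′ → m ≈ m′ → weight l m ≋ weight l′ m′
  weight-cong p q 0F = *-cong p q
  weight-cong p q 1F = p
  weight-cong p q 2F = p
  weight-cong p q 3F = p
  weight-cong p q 4F = *-cong p q
  weight-cong p q 5F = q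

  weight-1 : ∀ i → weight 1# 1# i ≈ 1#
  weight-1 0F = *-identityˡ 1#
  weight-1 1F = refl
  weight-1 2F = refl
  weight-1 3F = refl
  weight-1 4F = *-identityˡ 1#
  weight-1 5F = refl

  interchange : ∀ a b d e → (a * b) * (d * e) ≈ (a * d) * (b * e)
  interchange a b d e = begin
    (a * b) * (d * e)  ≈⟨ *-assoc a b (d * e) ⟩
    a * (b * (d * e))  ≈⟨ *-congˡ (*-assoc b d e) ⟨
    a * ((b * d) * e)  ≈⟨ *-congˡ (*-congʳ (*-comm b d)) ⟩
    a * ((d * b) * e)  ≈⟨ *-congˡ (*-assoc d b e) ⟩
    a * (d * (b * e))  ≈⟨ *-assoc a d (b * e) ⟨
    (a * d) * (b * e)  ∎

  weight-* : ∀ l m l′ m′ i →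
             weight (l * l′) (m * m′) i ≈ weight l m i * weight l′ m′ i
  weight-* l m l′ m′ 0F = interchange l l′ m m′
  weight-* l m l′ m′ 1F = refl
  weight-* l m l′ m′ 2F = refl
  weight-* l m l′ m′ 3F = refl
  weight-* l m l′ m′ 4F = interchange l l′ m m′
  weight-* l m l′ m′ 5F = refl

  1ₘ : 𝔾ₘ
  1ₘ = 1# , 1# , *-identityˡ 1# , *-identityˡ 1#

  _⁻¹ₘ : 𝔾ₘ → 𝔾ₘ
  (u , v , vu≈1 , uv≈1) ⁻¹ₘ = v , u , uv≈1 , vu≈1

  _*ₘ_ : 𝔾ₘ → 𝔾ₘ → 𝔾ₘ
  (u , v , vu , uv) *ₘ (u′ , v′ , vu′ , uv′) =
    u * u′ , v * v′ , inv vu vu′ , inv uv uv′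
    where
    inv : ∀ {a b a′ b′} → a * b ≈ 1# → a′ * b′ ≈ 1# → (a * a′) * (b * b′) ≈ 1#
    inv {a} {b} {a′} {b′} p q = begin
      (a * a′) * (b * b′)  ≈⟨ interchange a a′ b b′ ⟩
      (a * b) * (a′ * b′)  ≈⟨ *-cong p q ⟩
      1# * 1#              ≈⟨ *-identityˡ 1# ⟩
      1#                   ∎

  ∼-refl : ∀ {x} → x ∼ x
  ∼-refl {x} = (1ₘ , 1ₘ) , λ i → trans (*-congʳ (weight-1 i)) (*-identityˡ (x i))

  ∼-sym : ∀ {x y} → x ∼ y → y ∼ x
  ∼-sym {x} {y} ((l@(u , v , vu , _) , m@(u′ , v′ , vu′ , _)) , gx≋y) =
    (l ⁻¹ₘ , m ⁻¹ₘ) , λ i → begin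
      weight v v′ i * y i                    ≈⟨ *-congˡ (gx≋y i) ⟨
      weight v v′ i * (weight u u′ i * x i)  ≈⟨ *-assoc _ _ _ ⟨
      weight v v′ i * weight u u′ i * x i    ≈⟨ *-congʳ (weight-* v v′ u u′ i) ⟨
      weight (v * u) (v′ * u′) i * x i       ≈⟨ *-congʳ (weight-cong vu vu′ i) ⟩
      weight 1# 1# i * x i                   ≈⟨ *-congʳ (weight-1 i) ⟩
      1# * x i                               ≈⟨ *-identityˡ (x i) ⟩
      x i                                    ∎

  ∼-trans : ∀ {x y z} → x ∼ y → y ∼ z → x ∼ z
  ∼-trans {x} {y} {z} ((l , m) , gx≋y) ((l′ , m′) , hy≋z) =
    (l′ *ₘ l , m′ *ₘ m) , λ i → begin
      weight (proj₁ l′ * proj₁ l) (proj₁ m′ * proj₁ m) i * x i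
        ≈⟨ *-congʳ (weight-* (proj₁ l′) (proj₁ m′) (proj₁ l) (proj₁ m) i) ⟩
      weight (proj₁ l′) (proj₁ m′) i * weight (proj₁ l) (proj₁ m) i * x i
        ≈⟨ *-assoc _ _ _ ⟩
      weight (proj₁ l′) (proj₁ m′) i * (weight (proj₁ l) (proj₁ m) i * x i)
        ≈⟨ *-congˡ (gx≋y i) ⟩
      weight (proj₁ l′) (proj₁ m′) i * y i
        ≈⟨ hy≋z i ⟩
      z i ∎

  orbitSetoid : Setoid c (c ⊔ ℓ₁)
  orbitSetoid = record
    { Carrier       = 𝔸⁶
    ; _≈_           = _∼_
    ; isEquivalence = record { refl = ∼-refl ; sym = ∼-sym ; trans = ∼-trans }
    }

  -- K-points of the blow-up of P⁴ along L = {x₁ = x₂ = x₃ = 0}; quotients are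
  -- unavailable, so classes of K⁶ ∖ Z are represented by points up to _∼_.

  ℙ-Σ̃L : Setoid (c ⊔ ℓ₁) (c ⊔ ℓ₁)
  ℙ-Σ̃L = On.setoid {B = Σ[ x ∈ 𝔸⁶ ] ¬ Z x} orbitSetoid proj₁

  quintic : (P₃ Q₃ Q₄ : Polynomial 3) → 𝔸⁶ → Carrier
  quintic P₃ Q₃ Q₄ x =
      x 0F ^ 2 * eval P₃ x₁₂₃
    + x 0F * x 4F * eval Q₃ x₁₂₃
    + x 4F * x 5F * eval Q₄ x₁₂₃
    where
    x₁₂₃ : Vector Carrier 3
    x₁₂₃ = x 1F Vector.∷ x 2F Vector.∷ x 3F Vector.∷ Vector.[]

  -- For P₃, Q₃, Q₄ homogeneous of degrees 3, 3, 4 the quintic is bihomogeneous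
  -- of bidegree (5,2), so its vanishing depends only on the class of x.

  X̃₅⁽³⁾ : (P₃ Q₃ Q₄ : Polynomial 3) → Setoid (c ⊔ ℓ₁) (c ⊔ ℓ₁)
  X̃₅⁽³⁾ P₃ Q₃ Q₄ =
    On.setoid {B = Σ[ p ∈ Setoid.Carrier ℙ-Σ̃L ] quintic P₃ Q₃ Q₄ (proj₁ p) ≈ 0#}
              ℙ-Σ̃L proj₁

{-# OPTIONS --safe #-}
module Submission where

-- The blow-up maps to P² by (x₁ : x₂ : x₃), and the fibre of the hypersurface over b is
-- the plane conic α x₀² + β x₀ x₄ + γ x₄ x₅ = 0 with α, β, γ the values of P₃, Q₃, Q₄ at b.
-- Every such conic has 1 point modulo q.  On x₄ = 1, if γ ≠ 0 each x₀ determines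
-- x₅, and if γ = 0 then x₅ is free; either way the count is 0 modulo q.  On x₄ = 0, x₀ = 1 the
-- equation is α = 0 with x₅ free.  There remains the point x₄ = x₀ = 0, which always
-- lies on the conic.  Summing over the q² + q + 1 points of P² gives 1 modulo q.

open import Defs
open import Algebra.Apartness.Bundles using (HeytingField)
open import Algebra.Bundles using (CommutativeRing; Semiring)
open import Data.Empty using (⊥-elim)
open import Data.Fin.Base using (Fin; zero; suc)
open import Data.Fin.Patterns using (0F; 1F; 2F; 3F; 4F; 5F)
open import Data.Fin.Properties using (suc-injective; +↔⊎; any?; 1↔⊤)
  renaming (_≟_ to _≟ᶠ_)
import Data.Integer.Base as ℤ
import Data.Integer.Properties as ℤ
open import Data.List.Base using ([]; _∷_; length)
open import Data.Nat.Base using (ℕ; zero; suc; s≤s; _∸_)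
  renaming (_+_ to _+ℕ_; _*_ to _*ℕ_; _≤_ to _≤ℕ_)
import Data.Nat.Divisibility as ℕ
import Data.Nat.Properties as ℕ
open import Data.Nat.Solver using (module +-*-Solver)
open import Data.Product.Base using (_×_; _,_; proj₁; proj₂; Σ-syntax; ∃-syntax)
open import Data.Product.Relation.Binary.Pointwise.NonDependent using (_×ₛ_)
open import Data.Sum.Base using (_⊎_; inj₁; inj₂; [_,_])
open import Data.Sum.Function.Setoid using (_⊎-inverse_)
open import Data.Sum.Relation.Binary.Pointwise using (inj₁; inj₂; _⊎ₛ_; Pointwise-≡↔≡)
open import Data.Unit.Base using (⊤; tt)
open import Data.Vec.Base as Vec using (Vec)
import Data.Vec.Functional as Vector
open import Data.Vec.Functional using (Vector)
import Data.Vec.Properties as Vec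
open import Function.Base using (id; _∘_)
open import Function.Bundles using (Func; Inverse)
open import Function.Consequences.Setoid using (strictlySurjective⇒surjective)
import Function.Construct.Composition as Composition
import Function.Construct.Symmetry as Symmetry
open import Function.Definitions using (Congruent; Injective; StrictlySurjective)
open import Function.Properties.Bijection using (Bijection⇒Inverse)
open import Level using (Level; _⊔_)
open import Relation.Binary.Bundles using (Setoid)
import Relation.Binary.Construct.On as On
open import Relation.Binary.Definitions using (Decidable)
open import Relation.Binary.PropositionalEquality as ≡ using (_≡_; _≢_)
open import Relation.Nullary.Decidable using (Dec; yes; no; map′; decidable-stable)
open import Relation.Nullary.Negation using (¬_; contradiction)

private
  variable
    a b ℓ ℓ′ p p′ : Level

-- Counting setoids modulo q

Subsetoid : (S : Setoid a ℓ) → (Setoid.Carrier S → Set p) → Setoid (a ⊔ p) ℓ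
Subsetoid S P = On.setoid {B = Σ[ x ∈ Setoid.Carrier S ] P x} S proj₁

-- Strict surjectivity supplies a preimage of every point, and injectivity makes these preimages
-- respect equality.
bijective⇒inverse : (S : Setoid a ℓ) (T : Setoid b ℓ′) → let open Setoid in
  (f : Carrier S → Carrier T) → Congruent (_≈_ S) (_≈_ T) f → Injective (_≈_ S) (_≈_ T) f →
  StrictlySurjective (_≈_ T) f → Inverse S T
bijective⇒inverse S T f cong inj surj = Bijection⇒Inverse record
  { to = f ; cong = cong
  ; bijective = inj , strictlySurjective⇒surjective S T cong surj }

HasCardinality-resp-↔ : {S : Setoid a ℓ} {T : Setoid b ℓ′} {n : ℕ} →
                        Inverse S T → HasCardinality S n → HasCardinality T n
HasCardinality-resp-↔ S↔T = Composition.inverse (Symmetry.inverse S↔T)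

⊎-cardinality : {S : Setoid a ℓ} {T : Setoid b ℓ′} {m n : ℕ} →
  HasCardinality S m → HasCardinality T n → HasCardinality (S ⊎ₛ T) (m +ℕ n)
⊎-cardinality #S #T = Composition.inverse (#S ⊎-inverse #T)
  (Composition.inverse (Pointwise-≡↔≡ _ _) (Symmetry.inverse +↔⊎))

module Counting (q : ℕ) where

  -- Finiteness is part of the claim, and `r` is a natural number rather than a class, so residues
  -- add and multiply without subtraction.
  HasResidue : Setoid a ℓ → ℕ → Set (a ⊔ ℓ)
  HasResidue S r = ∃[ k ] HasCardinality S (r +ℕ k *ℕ q)

  residue-resp-↔ : {S : Setoid a ℓ} {T : Setoid b ℓ′} {r : ℕ} →
                   Inverse S T → HasResidue S r → HasResidue T r
  residue-resp-↔ S↔T (k , #S) = k , HasCardinality-resp-↔ S↔T #S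

  empty-residue : (S : Setoid a ℓ) → ¬ Setoid.Carrier S → HasResidue S 0
  empty-residue S empty = 0 , bijective⇒inverse S (≡.setoid (Fin 0))
    (⊥-elim ∘ empty) (λ {x} → ⊥-elim (empty x)) (λ {x} → ⊥-elim (empty x)) (λ ())

  ⊎-residue : {S : Setoid a ℓ} {T : Setoid b ℓ′} {r s : ℕ} →
              HasResidue S r → HasResidue T s → HasResidue (S ⊎ₛ T) (r +ℕ s)
  ⊎-residue {S = S} {T} {r} {s} (k , #S) (l , #T) = k +ℕ l ,
    ≡.subst (HasCardinality (S ⊎ₛ T))
      (solve 5 (λ r k s l q → (r :+ k :* q) :+ (s :+ l :* q) := (r :+ s) :+ (k :+ l) :* q)
             ≡.refl r k s l q)
      (⊎-cardinality #S #T)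
    where
    open +-*-Solver

  -- Disjointness is asked across equal elements because `P` and `Q` are not assumed to respect
  -- `_≈_`.
  split-residue : (S : Setoid a ℓ) → let open Setoid S in
    (P : Carrier → Set p) (Q : Carrier → Set p′) →
    (∀ x → P x ⊎ Q x) → (∀ {x y} → x ≈ y → P x → ¬ Q y) → {r s : ℕ} →
    HasResidue (Subsetoid S P) r → HasResidue (Subsetoid S Q) s → HasResidue S (r +ℕ s)
  split-residue S P Q cover disjoint #P #Q =
    residue-resp-↔ (bijective⇒inverse (Subsetoid S P ⊎ₛ Subsetoid S Q) S
      [ proj₁ , proj₁ ]
      (λ { (inj₁ e) → e ; (inj₂ e) → e })
      (λ { {inj₁ _}       {inj₁ _}       e → inj₁ e
         ; {inj₁ (_ , P)} {inj₂ (_ , Q)} e → contradiction Q (disjoint e P)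
         ; {inj₂ (_ , Q)} {inj₁ (_ , P)} e → contradiction Q (disjoint (sym e) P)
         ; {inj₂ _}       {inj₂ _}       e → inj₂ e })
      (λ x → [ (λ P → inj₁ (x , P) , refl) , (λ Q → inj₂ (x , Q) , refl) ] (cover x)))
      (⊎-residue #P #Q)
    where
    open Setoid S

  Fibre : {X : Setoid a ℓ} {S : Setoid b ℓ′} → Func X S → Setoid.Carrier S → Setoid (a ⊔ ℓ′) ℓ
  Fibre {X = X} {S} π s = Subsetoid X (λ x → Setoid._≈_ S (Func.to π x) s)

  -- Induction on `n`, splitting off the fibre over `zero`. The fibres may differ in size; only
  -- their common residue enters.
  Fin-fibration-residue : ∀ n {X : Setoid a ℓ} (π : Func X (≡.setoid (Fin n))) {r : ℕ} →
    (∀ i → HasResidue (Fibre π i) r) → HasResidue X (n *ℕ r)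
  Fin-fibration-residue zero {X} π #fib = empty-residue X (λ x → contradiction (Func.to π x) λ ())
  Fin-fibration-residue (suc n) {X} π {r} #fib =
    split-residue X (λ x → to x ≡ zero) Q cover
      (λ { x≈y eq (j , eq′) →
           contradiction (≡.trans (≡.sym eq) (≡.trans (cong x≈y) eq′)) λ () })
      (#fib zero)
      (Fin-fibration-residue n π′ (λ j → residue-resp-↔ (fibre↔ j) (#fib (suc j))))
    where
    open Func π
    -- Membership in `Q` carries the predecessor `j`, which is the value of the shifted map `π′`.
    Q = λ x → ∃[ j ] to x ≡ suc j
    cover : ∀ x → to x ≡ zero ⊎ Q x
    cover x with to x
    ... | zero  = inj₁ ≡.refl
    ... | suc j = inj₂ (j , ≡.refl)
    π′ : Func (Subsetoid X Q) (≡.setoid (Fin n))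
    π′ = record
      { to   = λ (_ , j , _) → j
      ; cong = λ { {_ , _ , eq} {_ , _ , eq′} x≈y →
                 suc-injective (≡.trans (≡.sym eq) (≡.trans (cong x≈y) eq′)) } }
    fibre↔ : ∀ j → Inverse (Fibre π (suc j)) (Fibre π′ j)
    fibre↔ j = bijective⇒inverse (Fibre π (suc j)) (Fibre π′ j)
      (λ (x , eq) → (x , j , eq) , ≡.refl) id id
      (λ ((x , _ , eq) , eq′) →
         (x , ≡.trans eq (≡.cong suc eq′)) , Setoid.refl X)

  -- The base is relabelled by its s + kq indices; then (s + kq)r + lq regroups as sr plus a
  -- multiple of q.
  fibration-residue : {X : Setoid a ℓ} {S : Setoid b ℓ′} (π : Func X S) {r s : ℕ} →
    HasResidue S s → (∀ t → HasResidue (Fibre π t) r) → HasResidue X (s *ℕ r)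
  fibration-residue {X = X} {S} π {r} {s} (k , #S) #fib =
    let l , #X = Fin-fibration-residue (s +ℕ k *ℕ q) (Composition.function π index)
                   (λ i → residue-resp-↔ (fibre↔ i) (#fib (from i)))
    in k *ℕ r +ℕ l , ≡.subst (HasCardinality X)
         (solve 5 (λ r s k l q →
              (s :+ k :* q) :* r :+ l :* q := s :* r :+ (k :* r :+ l) :* q)
            ≡.refl r s k l q) #X
    where
    open +-*-Solver
    open Inverse #S
    index : Func S (≡.setoid (Fin (s +ℕ k *ℕ q)))
    index = record { to = to ; cong = to-cong }
    fibre↔ : ∀ i → Inverse (Fibre π (from i)) (Fibre (Composition.function π index) i)
    fibre↔ i = bijective⇒inverse (Fibre π (from i)) (Fibre (Composition.function π index) i)
      (λ (x , e) → x , inverseˡ e) id id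
      (λ (x , e) → (x , Setoid.sym S (inverseʳ (≡.sym e))) , Setoid.refl X)

  Subsetoid-⊎-residue : {S : Setoid a ℓ} {T : Setoid b ℓ′} (P : Setoid.Carrier (S ⊎ₛ T) → Set p) →
    {r s : ℕ} → HasResidue (Subsetoid S (P ∘ inj₁)) r → HasResidue (Subsetoid T (P ∘ inj₂)) s →
    HasResidue (Subsetoid (S ⊎ₛ T) P) (r +ℕ s)
  Subsetoid-⊎-residue {S = S} {T} P #S #T = residue-resp-↔
    (bijective⇒inverse (Subsetoid S (P ∘ inj₁) ⊎ₛ Subsetoid T (P ∘ inj₂)) (Subsetoid (S ⊎ₛ T) P)
      [ (λ (x , Px) → inj₁ x , Px) , (λ (y , Py) → inj₂ y , Py) ]
      (λ { (inj₁ e) → inj₁ e ; (inj₂ e) → inj₂ e })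
      (λ { {inj₁ _} {inj₁ _} (inj₁ e) → inj₁ e ; {inj₂ _} {inj₂ _} (inj₂ e) → inj₂ e })
      (λ { (inj₁ x , Px) → inj₁ (x , Px) , inj₁ (Setoid.refl S)
         ; (inj₂ y , Py) → inj₂ (y , Py) , inj₂ (Setoid.refl T) }))
    (⊎-residue #S #T)

  Subsetoid-full-residue : (S : Setoid a ℓ) (P : Setoid.Carrier S → Set p) → (∀ x → P x) →
                           {r : ℕ} → HasResidue S r → HasResidue (Subsetoid S P) r
  Subsetoid-full-residue S P full = residue-resp-↔
    (bijective⇒inverse S (Subsetoid S P) (λ x → x , full x) id id
      (λ (x , _) → x , Setoid.refl S))

  -- The fibres of the first projection are slices of `P`. A fibre element has first coordinate `s`
  -- only up to `_≈_`, and the second hypothesis on `P` moves it onto the slice.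
  Subsetoid-×-residue : (S : Setoid a ℓ) (T : Setoid b ℓ′) → let open Setoid S in
    (P : Carrier × Setoid.Carrier T → Set p) →
    (∀ {s s′ t} → s ≈ s′ → P (s , t) → P (s′ , t)) → {r s : ℕ} →
    HasResidue S s → (∀ s → HasResidue (Subsetoid T (λ t → P (s , t))) r) →
    HasResidue (Subsetoid (S ×ₛ T) P) (s *ℕ r)
  Subsetoid-×-residue S T P resp #S #T = fibration-residue fst #S
    (λ s → residue-resp-↔
      (bijective⇒inverse (Subsetoid T (λ t → P (s , t))) (Fibre fst s)
         (λ (t , Pt) → ((s , t) , Pt) , refl) (λ e → refl , e) proj₂
         (λ (((_ , t) , Pst) , e) → (t , resp e Pst) , sym e , Setoid.refl T)) (#T s))
    where
    open Setoid S
    fst : Func (Subsetoid (S ×ₛ T) P) S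
    fst = record { to = λ ((s , _) , _) → s ; cong = proj₁ }

  ×-residue : {S : Setoid a ℓ} {T : Setoid b ℓ′} {r s : ℕ} →
              HasResidue S s → HasResidue T r → HasResidue (S ×ₛ T) (s *ℕ r)
  ×-residue {S = S} {T} #S #T = residue-resp-↔
    (bijective⇒inverse (Subsetoid (S ×ₛ T) (λ _ → ⊤)) (S ×ₛ T) proj₁ id id
       (λ x → (x , tt) , Setoid.refl (S ×ₛ T)))
    (Subsetoid-×-residue S T (λ _ → ⊤) (λ _ → id) #S
       (λ _ → Subsetoid-full-residue T (λ _ → ⊤) (λ _ → tt) #T))

  residue⇒mod : ∀ r k → r +ℕ k *ℕ q ≡ r mod q
  -- Integer divisibility is divisibility of absolute values, so `k` itself is the quotient once the
  -- difference is rewritten as kq.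
  residue⇒mod r k = ≡.subst (λ z → q ℕ.∣ ℤ.∣ z ∣) eq (ℕ.divides k ≡.refl)
    where
    open ≡.≡-Reasoning
    eq : ℤ.+ (k *ℕ q) ≡ ℤ.+ (r +ℕ k *ℕ q) ℤ.- ℤ.+ r
    eq = ≡.sym (begin
      ℤ.+ (r +ℕ k *ℕ q) ℤ.- ℤ.+ r  ≡⟨ ℤ.[+m]-[+n]≡m⊖n (r +ℕ k *ℕ q) r ⟩
      (r +ℕ k *ℕ q) ℤ.⊖ r         ≡⟨ ℤ.⊖-≥ (ℕ.m≤m+n r (k *ℕ q)) ⟩
      ℤ.+ (r +ℕ k *ℕ q ∸ r)      ≡⟨ ≡.cong ℤ.+_ (ℕ.m+n∸m≡n r (k *ℕ q)) ⟩
      ℤ.+ (k *ℕ q)                 ∎)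

module _ {c ℓ₁ ℓ₂ : Level} (F : HeytingField c ℓ₁ ℓ₂) (q : ℕ)
         (#F : HasCardinality (OverField.fieldSetoid F) q) where

  open OverField F
  open CommutativeRing commutativeRing hiding (zero)
  open HeytingField F using (heytingCommutativeRing; tight; #⇒invertible)
  open import Algebra.Apartness.Properties.HeytingCommutativeRing heytingCommutativeRing
    using (1#0; x-0≈x)
  open import Algebra.Definitions.RawSemiring (Semiring.rawSemiring semiring) using (_^_; product)
  open import Algebra.Properties.CommutativeSemiring.Exp commutativeSemiring
    using (^-congˡ; ^-homo-*; ^-distrib-*)
  open import Algebra.Properties.CommutativeMonoid.Sum *-commutativeMonoid
    using () renaming (sum-cong-≋ to product-cong)
  open import Algebra.Properties.Ring ring using (+-inverseʳ-unique)
  open import Algebra.Solver.Ring.NaturalCoefficients.Default commutativeSemiring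
    using (solve; _:=_; _:+_; _:*_; con)
  open import Data.Vec.Functional.Relation.Binary.Equality.Setoid setoid using (_≋_)
  open import Relation.Binary.Reasoning.Setoid setoid
  open Counting q
  private
    module #F = Inverse #F

  -- Finite fields

  infix 4 _≟_
  _≟_ : Decidable _≈_
  x ≟ y = map′ (λ e → trans (sym (#F.strictlyInverseʳ x))
                            (trans (#F.from-cong e) (#F.strictlyInverseʳ y)))
               #F.to-cong (#F.to x ≟ᶠ #F.to y)

  1≉0 : ¬ 1# ≈ 0#
  1≉0 1≈0 = proj₂ (tight 1# 0#) 1≈0 1#0

  inverse? : ∀ x → Dec (∃[ y ] y * x ≈ 1#)
  inverse? x = map′ (λ (i , e) → #F.from i , e)
    (λ (y , e) → #F.to y , trans (*-congʳ (#F.strictlyInverseʳ y)) e)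
    (any? λ i → #F.from i * x ≟ 1#)

  -- Tightness turns `¬ x ≈ 0#` only into the double negation of apartness. Searching the finite
  -- field for an inverse is decidable, which removes the double negation.
  inverse : ∀ {x} → ¬ x ≈ 0# → ∃[ y ] y * x ≈ 1#
  inverse {x} x≉0 = decidable-stable (inverse? x) λ ¬inv → x≉0 (proj₁ (tight x 0#) λ x#0 →
    let y , yx , _ = #⇒invertible x#0 in ¬inv (y , trans (*-congˡ (sym (x-0≈x x))) yx))

  unit : ∀ {x} → ¬ x ≈ 0# → 𝔾ₘ
  unit {x} x≉0 = let y , yx = inverse x≉0 in x , y , yx , trans (*-comm x y) yx

  unit≉0 : (u : 𝔾ₘ) → ¬ proj₁ u ≈ 0#
  unit≉0 (u , v , vu , _) u≈0 = 1≉0 (trans (sym vu) (trans (*-congˡ u≈0) (zeroʳ v)))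

  unit-cancel : (u : 𝔾ₘ) → ∀ {x} → proj₁ u * x ≈ 0# → x ≈ 0#
  unit-cancel (u , v , vu , _) {x} ux≈0 = begin
    x            ≈⟨ *-identityˡ x ⟨
    1# * x       ≈⟨ *-congʳ vu ⟨
    v * u * x    ≈⟨ *-assoc v u x ⟩
    v * (u * x)  ≈⟨ *-congˡ ux≈0 ⟩
    v * 0#       ≈⟨ zeroʳ v ⟩
    0#           ∎

  unit-divide : (u : 𝔾ₘ) (x : Carrier) → proj₁ u * (proj₁ (proj₂ u) * x) ≈ x
  unit-divide (u , v , _ , uv) x =
    trans (sym (*-assoc u v x)) (trans (*-congʳ uv) (*-identityˡ x))

  -- Homogeneous polynomials

  -- Replacing the monomials by an arbitrary weight makes evaluation linear in the
  -- weight, so that weights agreeing where coeff is nonzero can be exchanged.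
  weigh : ∀ {n} → (Vec ℕ n → Carrier) → Polynomial n → Carrier
  weigh w []            = 0#
  weigh w ((a , e) ∷ p) = a * w e + weigh w p

  weigh-cong : ∀ {n} {w w′ : Vec ℕ n → Carrier} → (∀ m → w m ≈ w′ m) →
               ∀ p → weigh w p ≈ weigh w′ p
  weigh-cong w≈w′ []            = refl
  weigh-cong w≈w′ ((a , e) ∷ p) = +-cong (*-congˡ (w≈w′ e)) (weigh-cong w≈w′ p)

  weigh-scale : ∀ {n} s (w : Vec ℕ n → Carrier) p → weigh (λ m → s * w m) p ≈ s * weigh w p
  weigh-scale s w []            = sym (zeroʳ s)
  weigh-scale s w ((a , e) ∷ p) = trans (+-congˡ (weigh-scale s w p))
    (solve 4 (λ s a e p → a :* (s :* e) :+ s :* p := s :* (a :* e :+ p)) refl s a (w e) (weigh w p))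

  -- All terms with exponent `m` go at once, since an uncollected list may repeat an exponent.
  erase : ∀ {n} → Vec ℕ n → Polynomial n → Polynomial n
  erase m []            = []
  erase m ((a , e) ∷ p) with Vec.≡-dec ℕ._≟_ e m
  ... | yes _ = erase m p
  ... | no  _ = (a , e) ∷ erase m p

  length-erase : ∀ {n} (m : Vec ℕ n) p → length (erase m p) ≤ℕ length p
  length-erase m []            = ℕ.≤-refl
  length-erase m ((a , e) ∷ p) with Vec.≡-dec ℕ._≟_ e m
  ... | yes _ = ℕ.m≤n⇒m≤1+n (length-erase m p)
  ... | no  _ = s≤s (length-erase m p)

  coeff-erase-≡ : ∀ {n} (m : Vec ℕ n) p → coeff (erase m p) m ≈ 0#
  coeff-erase-≡ m []            = refl
  coeff-erase-≡ m ((a , e) ∷ p) with Vec.≡-dec ℕ._≟_ e m in eq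
  ... | yes _ = coeff-erase-≡ m p
  ... | no  _ rewrite eq = trans (+-identityˡ _) (coeff-erase-≡ m p)

  coeff-erase-≢ : ∀ {n} {m m′ : Vec ℕ n} → m ≢ m′ → ∀ p → coeff (erase m p) m′ ≈ coeff p m′
  coeff-erase-≢ m≢m′ [] = refl
  coeff-erase-≢ {m = m} {m′} m≢m′ ((a , e) ∷ p) with Vec.≡-dec ℕ._≟_ e m
  ... | no  _ = +-congˡ (coeff-erase-≢ m≢m′ p)
  ... | yes ≡.refl with Vec.≡-dec ℕ._≟_ e m′
  ...   | yes e≡m′ = contradiction e≡m′ m≢m′
  ...   | no  _    = trans (coeff-erase-≢ m≢m′ p) (sym (+-identityˡ _))

  -- Erasing never enlarges the support, so a hypothesis about the nonzero coefficients of `p`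
  -- passes to `erase m p`.
  coeff-erase-0 : ∀ {n} (m m′ : Vec ℕ n) p → coeff p m′ ≈ 0# → coeff (erase m p) m′ ≈ 0#
  coeff-erase-0 m m′ p z with Vec.≡-dec ℕ._≟_ m m′
  ... | yes ≡.refl = coeff-erase-≡ m p
  ... | no m≢m′    = trans (coeff-erase-≢ m≢m′ p) z

  -- Terms with exponent `m` share the weight `w m`, so their coefficients collect to `coeff p m`.
  weigh-erase : ∀ {n} (w : Vec ℕ n → Carrier) m p →
                weigh w p ≈ coeff p m * w m + weigh w (erase m p)
  weigh-erase w m [] = sym (trans (+-identityʳ _) (zeroˡ _))
  weigh-erase w m ((a , e) ∷ p) with Vec.≡-dec ℕ._≟_ e m
  ... | yes ≡.refl = trans (+-congˡ (weigh-erase w m p))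
    (solve 4 (λ a x c r → a :* x :+ (c :* x :+ r) := (a :+ c) :* x :+ r) refl
       a (w m) (coeff p m) (weigh w (erase m p)))
  ... | no _ = trans (+-congˡ (weigh-erase w m p))
    (solve 4 (λ t x c r → t :+ (c :* x :+ r) := (con 0 :+ c) :* x :+ (t :+ r)) refl
       (a * w e) (w m) (coeff p m) (weigh w (erase m p)))

  -- A termwise comparison fails, because terms outside the support may cancel only after
  -- collection. Instead the head exponent is collected and erased; the recursion runs on the length
  -- bound `k`, since the erased list is not a structural subterm.
  weigh-support : ∀ {n} {w w′ : Vec ℕ n → Carrier} (p : Polynomial n) →
    (∀ m → ¬ coeff p m ≈ 0# → w m ≈ w′ m) → weigh w p ≈ weigh w′ p
  weigh-support {n} {w} {w′} p = go (length p) p ℕ.≤-refl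
    where
    go : ∀ k (p : Polynomial n) → length p ≤ℕ k →
         (∀ m → ¬ coeff p m ≈ 0# → w m ≈ w′ m) → weigh w p ≈ weigh w′ p
    go k       []                _       w≈w′ = refl
    go (suc k) p@((_ , e) ∷ p′) (s≤s le) w≈w′ = begin
      weigh w p                                  ≈⟨ weigh-erase w e p ⟩
      coeff p e * w e + weigh w (erase e p)      ≈⟨ +-cong first rest ⟩
      coeff p e * w′ e + weigh w′ (erase e p)    ≈⟨ weigh-erase w′ e p ⟨
      weigh w′ p                                 ∎
      where
      first : coeff p e * w e ≈ coeff p e * w′ e
      first with coeff p e ≟ 0#
      ... | yes z = trans (*-congʳ z) (trans (zeroˡ _) (sym (trans (*-congʳ z) (zeroˡ _))))
      ... | no nz = *-congˡ (w≈w′ e nz)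
      -- The head term has exponent `e` itself, so at least one term disappears.
      shorter : length (erase e p) ≤ℕ k
      shorter with Vec.≡-dec ℕ._≟_ e e
      ... | yes _  = ℕ.≤-trans (length-erase e p′) le
      ... | no e≢e = contradiction ≡.refl e≢e
      rest : weigh w (erase e p) ≈ weigh w′ (erase e p)
      rest = go k (erase e p) shorter λ m nz → w≈w′ m (nz ∘ coeff-erase-0 e m p)

  monomial : ∀ {n} → Vector Carrier n → Vec ℕ n → Carrier
  monomial x e = product (λ i → x i ^ Vec.lookup e i)

  eval≈weigh : ∀ {n} (p : Polynomial n) x → eval p x ≈ weigh (monomial x) p
  eval≈weigh []            x = refl
  eval≈weigh ((a , e) ∷ p) x = +-congˡ (eval≈weigh p x)

  eval-cong : ∀ {n} (p : Polynomial n) {x y} → x ≋ y → eval p x ≈ eval p y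
  eval-cong p {x} {y} x≋y = begin
    eval p x              ≈⟨ eval≈weigh p x ⟩
    weigh (monomial x) p  ≈⟨ weigh-cong (λ m → product-cong λ i →
                               ^-congˡ (Vec.lookup m i) (x≋y i)) p ⟩
    weigh (monomial y) p  ≈⟨ eval≈weigh p y ⟨
    eval p y              ∎

  monomial-scale : ∀ {n} s (x : Vector Carrier n) e →
                   monomial (λ i → s * x i) e ≈ s ^ Vec.sum e * monomial x e
  monomial-scale s x Vec.[]       = sym (*-identityˡ 1#)
  monomial-scale s x (k Vec.∷ e) = begin
    (s * x 0F) ^ k * monomial (λ i → s * x (suc i)) e
      ≈⟨ *-cong (^-distrib-* s (x 0F) k) (monomial-scale s (x ∘ suc) e) ⟩
    (s ^ k * x 0F ^ k) * (s ^ Vec.sum e * monomial (x ∘ suc) e)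
      ≈⟨ interchange _ _ _ _ ⟩
    (s ^ k * s ^ Vec.sum e) * (x 0F ^ k * monomial (x ∘ suc) e)
      ≈⟨ *-congʳ (^-homo-* s k (Vec.sum e)) ⟨
    s ^ (k +ℕ Vec.sum e) * (x 0F ^ k * monomial (x ∘ suc) e)  ∎

  -- Scaling multiplies the monomial of exponent `m` by `s ^ Vec.sum m`, and on the support this sum
  -- is `d`.
  eval-homogeneous : ∀ {n d} (p : Polynomial n) → IsHomogeneous d p → ∀ s x →
                     eval p (λ i → s * x i) ≈ s ^ d * eval p x
  eval-homogeneous {d = d} p hom s x = begin
    eval p (λ i → s * x i)              ≈⟨ eval≈weigh p _ ⟩
    weigh (monomial (λ i → s * x i)) p  ≈⟨ weigh-support p (λ m nz →
      trans (monomial-scale s x m) (*-congʳ (reflexive (≡.cong (s ^_) (hom m nz))))) ⟩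
    weigh (λ m → s ^ d * monomial x m) p  ≈⟨ weigh-scale (s ^ d) (monomial x) p ⟩
    s ^ d * weigh (monomial x) p          ≈⟨ *-congˡ (eval≈weigh p x) ⟨
    s ^ d * eval p x                      ∎

  -- Normal forms of points of the projective plane

  -- The first nonzero coordinate is 1: (1 : y : z), (0 : 1 : z) or (0 : 0 : 1).
  Plane : Set c
  Plane = (Carrier × Carrier) ⊎ (Carrier ⊎ ⊤)

  planeSetoid : Setoid c (c ⊔ ℓ₁)
  planeSetoid = (fieldSetoid ×ₛ fieldSetoid) ⊎ₛ (fieldSetoid ⊎ₛ ≡.setoid ⊤)

  open Setoid planeSetoid using () renaming (_≈_ to _≈ₚ_)

  ⟦_⟧ : Plane → Vector Carrier 3
  ⟦ inj₁ (y , z) ⟧   = 1# Vector.∷ y  Vector.∷ z  Vector.∷ Vector.[]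
  ⟦ inj₂ (inj₁ z) ⟧  = 0# Vector.∷ 1# Vector.∷ z  Vector.∷ Vector.[]
  ⟦ inj₂ (inj₂ tt) ⟧ = 0# Vector.∷ 0# Vector.∷ 1# Vector.∷ Vector.[]

  field-residue : HasResidue fieldSetoid 0
  field-residue = 1 , ≡.subst (HasCardinality fieldSetoid) (≡.sym (ℕ.*-identityˡ q)) #F

  ⊤-residue : HasResidue (≡.setoid ⊤) 1
  ⊤-residue = 0 , Symmetry.inverse 1↔⊤

  -- The three kinds of normal form give q² + q + 1 points.
  plane-residue : HasResidue planeSetoid 1
  plane-residue = ⊎-residue (×-residue field-residue field-residue) (⊎-residue field-residue ⊤-residue)

  ⟦⟧-cong : ∀ {n n′} → n ≈ₚ n′ → ⟦ n ⟧ ≋ ⟦ n′ ⟧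
  ⟦⟧-cong (inj₁ (y , z))         0F = refl
  ⟦⟧-cong (inj₁ (y , z))         1F = y
  ⟦⟧-cong (inj₁ (y , z))         2F = z
  ⟦⟧-cong (inj₂ (inj₁ z))        0F = refl
  ⟦⟧-cong (inj₂ (inj₁ z))        1F = refl
  ⟦⟧-cong (inj₂ (inj₁ z))        2F = z
  ⟦⟧-cong (inj₂ (inj₂ ≡.refl))   i  = refl

  ⟦⟧-nonzero : ∀ n → ¬ (⟦ n ⟧ 0F ≈ 0# × ⟦ n ⟧ 1F ≈ 0# × ⟦ n ⟧ 2F ≈ 0#)
  ⟦⟧-nonzero (inj₁ _)          (z , _ , _) = 1≉0 z
  ⟦⟧-nonzero (inj₂ (inj₁ _))   (_ , z , _) = 1≉0 z
  ⟦⟧-nonzero (inj₂ (inj₂ tt))  (_ , _ , z) = 1≉0 z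

  -- The unit is the first nonzero coordinate, by which the later ones are divided.
  normalise : (v : Vector Carrier 3) → ¬ (v 0F ≈ 0# × v 1F ≈ 0# × v 2F ≈ 0#) →
              Σ[ u ∈ 𝔾ₘ ] ∃[ n ] (∀ i → proj₁ u * ⟦ n ⟧ i ≈ v i)
  normalise v v≉0 with v 0F ≟ 0# | v 1F ≟ 0# | v 2F ≟ 0#
  ... | no x≉0  | _       | _ = u , inj₁ (proj₁ (proj₂ u) * v 1F , proj₁ (proj₂ u) * v 2F) , λ
    { 0F → *-identityʳ _ ; 1F → unit-divide u _ ; 2F → unit-divide u _ }
    where u = unit x≉0
  ... | yes x≈0 | no y≉0  | _ = u , inj₂ (inj₁ (proj₁ (proj₂ u) * v 2F)) , λ
    { 0F → trans (zeroʳ _) (sym x≈0) ; 1F → *-identityʳ _ ; 2F → unit-divide u _ }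
    where u = unit y≉0
  ... | yes x≈0 | yes y≈0 | no z≉0  = unit z≉0 , inj₂ (inj₂ tt) , λ
    { 0F → trans (zeroʳ _) (sym x≈0) ; 1F → trans (zeroʳ _) (sym y≈0) ; 2F → *-identityʳ _ }
  ... | yes x≈0 | yes y≈0 | yes z≈0 = contradiction (x≈0 , y≈0 , z≈0) v≉0

  -- Leading ones in different positions would make the unit vanish or 1 equal 0. In the same
  -- position they force the unit to be 1, and the other coordinates then agree.
  normal-unique : (u : 𝔾ₘ) → ∀ n n′ → (∀ i → proj₁ u * ⟦ n ⟧ i ≈ ⟦ n′ ⟧ i) →
                  proj₁ u ≈ 1# × n ≈ₚ n′
  normal-unique u@(x , _) = go
    where
    is-one : x * 1# ≈ 1# → x ≈ 1#
    is-one e = trans (sym (*-identityʳ x)) e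
    drop-unit : ∀ {y y′} → x * 1# ≈ 1# → x * y ≈ y′ → y ≈ y′
    drop-unit e e′ = trans (sym (trans (*-congʳ (is-one e)) (*-identityˡ _))) e′
    1↦0 : x * 1# ≈ 0# → ∀ {a} {A : Set a} → A
    1↦0 e = contradiction (trans (sym (*-identityʳ x)) e) (unit≉0 u)
    0↦1 : x * 0# ≈ 1# → ∀ {a} {A : Set a} → A
    0↦1 e = contradiction (trans (sym e) (zeroʳ x)) 1≉0
    go : ∀ n n′ → (∀ i → x * ⟦ n ⟧ i ≈ ⟦ n′ ⟧ i) → x ≈ 1# × n ≈ₚ n′
    go (inj₁ _)         (inj₁ _)         e =
      is-one (e 0F) , inj₁ (drop-unit (e 0F) (e 1F) , drop-unit (e 0F) (e 2F))
    go (inj₁ _)         (inj₂ (inj₁ _))  e = 1↦0 (e 0F)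
    go (inj₁ _)         (inj₂ (inj₂ tt)) e = 1↦0 (e 0F)
    go (inj₂ (inj₁ _))  (inj₁ _)         e = 0↦1 (e 0F)
    go (inj₂ (inj₁ _))  (inj₂ (inj₁ _))  e = is-one (e 1F) , inj₂ (inj₁ (drop-unit (e 1F) (e 2F)))
    go (inj₂ (inj₁ _))  (inj₂ (inj₂ tt)) e = 1↦0 (e 1F)
    go (inj₂ (inj₂ tt)) (inj₁ _)         e = 0↦1 (e 0F)
    go (inj₂ (inj₂ tt)) (inj₂ (inj₁ _))  e = 0↦1 (e 1F)
    go (inj₂ (inj₂ tt)) (inj₂ (inj₂ tt)) e = is-one (e 2F) , inj₂ (inj₂ ≡.refl)

  -- Counting points of a fibre

  -- On a fibre the plane coordinates are taken in the order (x₄ : x₀ : x₅).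
  conic : Carrier → Carrier → Carrier → Plane → Carrier
  conic α β γ t = ⟦ t ⟧ 1F ^ 2 * α + ⟦ t ⟧ 1F * ⟦ t ⟧ 0F * β + ⟦ t ⟧ 0F * ⟦ t ⟧ 2F * γ

  -- The only root is -h/r. The factor `1#` is the coordinate x₄ = 1 as it occurs in `conic`.
  root-residue : ∀ {r} → ¬ r ≈ 0# → ∀ h →
                 HasResidue (Subsetoid fieldSetoid (λ x → h + 1# * x * r ≈ 0#)) 1
  root-residue {r} r≉0 h = residue-resp-↔
    (bijective⇒inverse (≡.setoid ⊤) (Subsetoid fieldSetoid (λ x → h + 1# * x * r ≈ 0#))
       (λ _ → s * - h , root) (λ _ → refl) (λ _ → ≡.refl) (λ (x , e) → tt , unique x e))
    ⊤-residue
    where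
    s = proj₁ (inverse r≉0)
    sr = proj₂ (inverse r≉0)
    root : h + 1# * (s * - h) * r ≈ 0#
    root = begin
      h + 1# * (s * - h) * r  ≈⟨ +-congˡ (*-congʳ (*-identityˡ _)) ⟩
      h + s * - h * r         ≈⟨ +-congˡ (solve 3 (λ s h r → s :* h :* r := s :* r :* h) refl s (- h) r) ⟩
      h + s * r * - h         ≈⟨ +-congˡ (*-congʳ sr) ⟩
      h + 1# * - h            ≈⟨ +-congˡ (*-identityˡ _) ⟩
      h - h                   ≈⟨ -‿inverseʳ h ⟩
      0#                      ∎
    unique : ∀ x → h + 1# * x * r ≈ 0# → s * - h ≈ x
    unique x e = begin
      s * - h           ≈⟨ *-congˡ (+-inverseʳ-unique h _ e) ⟨
      s * (1# * x * r)  ≈⟨ *-congˡ (*-congʳ (*-identityˡ x)) ⟩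
      s * (x * r)       ≈⟨ solve 3 (λ s x r → s :* (x :* r) := s :* r :* x) refl s x r ⟩
      s * r * x         ≈⟨ *-congʳ sr ⟩
      1# * x            ≈⟨ *-identityˡ x ⟩
      x                 ∎

  -- The condition does not depend on `x`, so it holds for all q elements or for none.
  constant-residue : (P : Carrier → Set ℓ₁) (h : Carrier) → (∀ x → h ≈ 0# → P x) →
                     (∀ x → P x → h ≈ 0#) → HasResidue (Subsetoid fieldSetoid P) 0
  constant-residue P h if onlyIf with h ≟ 0#
  ... | yes h≈0 = Subsetoid-full-residue fieldSetoid P (λ x → if x h≈0) field-residue
  ... | no  h≉0 = empty-residue (Subsetoid fieldSetoid P) (λ (x , Px) → h≉0 (onlyIf x Px))

  conic-residue : ∀ α β γ → HasResidue (Subsetoid planeSetoid (λ t → conic α β γ t ≈ 0#)) 1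
  conic-residue α β γ =
    -- The pieces are x₄ = 1, then x₄ = 0 with x₀ = 1, then the point x₄ = x₀ = 0, contributing 0, 0
    -- and 1.
    Subsetoid-⊎-residue (λ t → conic α β γ t ≈ 0#) affine
      (Subsetoid-⊎-residue (λ t → conic α β γ (inj₂ t) ≈ 0#) line
         (Subsetoid-full-residue (≡.setoid ⊤) _ (λ _ → centre) ⊤-residue))
    where
    resp : ∀ {x x′ y} → x ≈ x′ → conic α β γ (inj₁ (x , y)) ≈ 0# → conic α β γ (inj₁ (x′ , y)) ≈ 0#
    resp x≈x′ = trans (+-congʳ (+-cong (*-congʳ (^-congˡ 2 (sym x≈x′)))
                                       (*-congʳ (*-congʳ (sym x≈x′)))))

    affine : HasResidue (Subsetoid (fieldSetoid ×ₛ fieldSetoid) (λ t → conic α β γ (inj₁ t) ≈ 0#)) 0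
    affine with γ ≟ 0#
    ... | yes γ≈0 = Subsetoid-×-residue fieldSetoid fieldSetoid (λ t → conic α β γ (inj₁ t) ≈ 0#) resp
      field-residue
      (λ x → constant-residue _ (x ^ 2 * α + x * 1# * β)
         (λ y e → trans (drop y) e) (λ y e → trans (sym (drop y)) e))
      where
      drop : ∀ {h} y → h + 1# * y * γ ≈ h
      drop y = trans (+-congˡ (trans (*-congˡ γ≈0) (zeroʳ _))) (+-identityʳ _)
    ... | no γ≉0 = Subsetoid-×-residue fieldSetoid fieldSetoid (λ t → conic α β γ (inj₁ t) ≈ 0#) resp
      field-residue (λ x → root-residue γ≉0 _)

    line : HasResidue (Subsetoid fieldSetoid (λ t → conic α β γ (inj₂ (inj₁ t)) ≈ 0#)) 0
    line = constant-residue _ α (λ x → trans (value x)) (λ x → trans (sym (value x)))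
      where
      value : ∀ x → 1# ^ 2 * α + 1# * 0# * β + 0# * x * γ ≈ α
      value x = begin
        1# ^ 2 * α + 1# * 0# * β + 0# * x * γ
          -- The variable `e` stands for `1#`, including the one that ends the unfolded square; the
          -- identity laws remove it afterwards.
          ≈⟨ solve 5 (λ e α β x γ → e :* (e :* e) :* α :+ e :* con 0 :* β :+ con 0 :* x :* γ
                                 := e :* (e :* (e :* α))) refl 1# α β x γ ⟩
        1# * (1# * (1# * α))  ≈⟨ *-identityˡ _ ⟩
        1# * (1# * α)         ≈⟨ *-identityˡ _ ⟩
        1# * α                ≈⟨ *-identityˡ _ ⟩
        α                     ∎

    centre : 0# ^ 2 * α + 0# * 0# * β + 0# * 1# * γ ≈ 0#
    centre = solve 4 (λ e α β γ → con 0 :* (con 0 :* e) :* α :+ con 0 :* con 0 :* β :+ con 0 :* e :* γ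
                               := con 0) refl 1# α β γ

  -- Points of the blow-up

  -- The blow-up is a P²-bundle over P²: `b` fixes (x₁ : x₂ : x₃) and with it λ, after which μ
  -- scales (x₄ : x₀ : x₅) uniformly and `t` fixes it.
  point : Plane → Plane → 𝔸⁶
  point b t 0F = ⟦ t ⟧ 1F
  point b t 1F = ⟦ b ⟧ 0F
  point b t 2F = ⟦ b ⟧ 1F
  point b t 3F = ⟦ b ⟧ 2F
  point b t 4F = ⟦ t ⟧ 0F
  point b t 5F = ⟦ t ⟧ 2F

  point-cong : ∀ {b b′ t t′} → b ≈ₚ b′ → t ≈ₚ t′ → point b t ≋ point b′ t′
  point-cong b≈ t≈ 0F = ⟦⟧-cong t≈ 1F
  point-cong b≈ t≈ 1F = ⟦⟧-cong b≈ 0F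
  point-cong b≈ t≈ 2F = ⟦⟧-cong b≈ 1F
  point-cong b≈ t≈ 3F = ⟦⟧-cong b≈ 2F
  point-cong b≈ t≈ 4F = ⟦⟧-cong t≈ 0F
  point-cong b≈ t≈ 5F = ⟦⟧-cong t≈ 2F

  point∉Z : ∀ b t → ¬ Z (point b t)
  point∉Z b t (inj₁ z)             = ⟦⟧-nonzero b z
  point∉Z b t (inj₂ (z₀ , z₄ , z₅)) = ⟦⟧-nonzero t (z₄ , z₀ , z₅)

  ≋⇒∼ : ∀ {x y} → x ≋ y → x ∼ y
  ≋⇒∼ {x} x≋y = let g , e = ∼-refl {x} in g , λ i → trans (e i) (x≋y i)

  -- The base coordinates force λ = 1, so the weights λμ, λμ, μ on the fibre all become μ and
  -- uniqueness applies a second time.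
  point-injective : ∀ {b b′ t t′} → point b t ∼ point b′ t′ → b ≈ₚ b′ × t ≈ₚ t′
  point-injective {b} {b′} {t} {t′} ((l , m) , e) =
    let l≈1 , b≈ = normal-unique l b b′ λ { 0F → e 1F ; 1F → e 2F ; 2F → e 3F }
        drop : ∀ {x y} → proj₁ l * proj₁ m * x ≈ y → proj₁ m * x ≈ y
        drop = trans (sym (*-congʳ (trans (*-congʳ l≈1) (*-identityˡ _))))
        _ , t≈ = normal-unique m t t′ λ { 0F → drop (e 4F) ; 1F → drop (e 0F) ; 2F → e 5F }
    in b≈ , t≈

  point-surjective : ∀ x → ¬ Z x → ∃[ b ] ∃[ t ] point b t ∼ x
  point-surjective x x∉Z =
    let l , b , eb = normalise (x 1F Vector.∷ x 2F Vector.∷ x 3F Vector.∷ Vector.[]) (x∉Z ∘ inj₁)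
        l⁻¹ = l ⁻¹ₘ
        -- Of the fibre coordinates only x₄ and x₀ carry the weight λ, so these two are divided by
        -- `l` before normalising.
        m , t , et = normalise
          (proj₁ l⁻¹ * x 4F Vector.∷ proj₁ l⁻¹ * x 0F Vector.∷ x 5F Vector.∷ Vector.[])
          (λ (z₄ , z₀ , z₅) → x∉Z (inj₂ (unit-cancel l⁻¹ z₀ , unit-cancel l⁻¹ z₄ , z₅)))
        lift : ∀ {y z} → proj₁ m * y ≈ proj₁ l⁻¹ * z → proj₁ l * proj₁ m * y ≈ z
        lift e = trans (*-assoc _ _ _) (trans (*-congˡ e) (unit-divide l _))
    in b , t , (l , m) , λ
      { 0F → lift (et 1F) ; 1F → eb 0F ; 2F → eb 1F ; 3F → eb 2F ; 4F → lift (et 0F) ; 5F → et 2F }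

  -- Bihomogeneity of the quintic and the point count of the hypersurface

  module _ (P₃ Q₃ Q₄ : Polynomial 3) (hP₃ : IsHomogeneous 3 P₃) (hQ₃ : IsHomogeneous 3 Q₃)
           (hQ₄ : IsHomogeneous 4 Q₄) where

    f : 𝔸⁶ → Carrier
    f = quintic P₃ Q₃ Q₄

    x₁₂₃ : 𝔸⁶ → Vector Carrier 3
    x₁₂₃ x = x 1F Vector.∷ x 2F Vector.∷ x 3F Vector.∷ Vector.[]

    x₁₂₃-cong : ∀ {x y} → x ≋ y → x₁₂₃ x ≋ x₁₂₃ y
    x₁₂₃-cong x≋y = λ { 0F → x≋y 1F ; 1F → x≋y 2F ; 2F → x≋y 3F }

    quintic-cong : ∀ {x y} → x ≋ y → f x ≈ f y
    quintic-cong x≋y = +-cong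
      (+-cong (*-cong (^-congˡ 2 (x≋y 0F)) (eval-cong P₃ (x₁₂₃-cong x≋y)))
              (*-cong (*-cong (x≋y 0F) (x≋y 4F)) (eval-cong Q₃ (x₁₂₃-cong x≋y))))
      (*-cong (*-cong (x≋y 4F) (x≋y 5F)) (eval-cong Q₄ (x₁₂₃-cong x≋y)))

    -- Each term acquires λ⁵μ²: the first two as (λμ)² · λ³, the last as λμ · μ · λ⁴.
    quintic-bihomogeneous : ∀ (g : 𝔾ₘ × 𝔾ₘ) (x : 𝔸⁶) →
      let (l , _) , (m , _) = g in f (g · x) ≈ l ^ 5 * (m * m) * f x
    quintic-bihomogeneous g@((l , _) , (m , _)) x = trans
      (+-cong (+-cong (*-congˡ (scale P₃ hP₃)) (*-congˡ (scale Q₃ hQ₃))) (*-congˡ (scale Q₄ hQ₄)))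
      -- The unit hidden in the powers is passed to the solver as a variable e.
      (solve 9 (λ l m x₀ x₄ x₅ p q r e →
           let lmx₀ = l :* m :* x₀
               lmx₄ = l :* m :* x₄
               l³   = l :* (l :* (l :* e))
               l⁴   = l :* l³
               l⁵   = l :* l⁴
           in lmx₀ :* (lmx₀ :* e) :* (l³ :* p) :+ lmx₀ :* lmx₄ :* (l³ :* q)
                :+ lmx₄ :* (m :* x₅) :* (l⁴ :* r)
              := l⁵ :* (m :* m) :* (x₀ :* (x₀ :* e) :* p :+ x₀ :* x₄ :* q :+ x₄ :* x₅ :* r))
         refl l m (x 0F) (x 4F) (x 5F)
         (eval P₃ (x₁₂₃ x)) (eval Q₃ (x₁₂₃ x)) (eval Q₄ (x₁₂₃ x)) 1#)
      where
      scale : ∀ {d} p → IsHomogeneous d p → eval p (x₁₂₃ (g · x)) ≈ l ^ d * eval p (x₁₂₃ x)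
      scale p hp = trans (eval-cong p λ { 0F → refl ; 1F → refl ; 2F → refl })
                         (eval-homogeneous p hp l (x₁₂₃ x))

    vanish-resp-∼ : ∀ {x y} → x ∼ y → f x ≈ 0# → f y ≈ 0#
    vanish-resp-∼ {x} {y} (g , e) fx≈0 = begin
      f y         ≈⟨ quintic-cong e ⟨
      f (g · x)   ≈⟨ quintic-bihomogeneous g x ⟩
      _ * f x     ≈⟨ *-congˡ fx≈0 ⟩
      _ * 0#      ≈⟨ zeroʳ _ ⟩
      0#          ∎

    normalFormSetoid : Setoid (c ⊔ ℓ₁) (c ⊔ ℓ₁)
    normalFormSetoid = Subsetoid (planeSetoid ×ₛ planeSetoid) (λ (b , t) → f (point b t) ≈ 0#)

    normalForm-residue : HasResidue normalFormSetoid 1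
    normalForm-residue = Subsetoid-×-residue planeSetoid planeSetoid (λ (b , t) → f (point b t) ≈ 0#)
      (λ {b} {b′} {t} b≈b′ e →
         trans (quintic-cong (point-cong (Setoid.sym planeSetoid b≈b′) (Setoid.refl planeSetoid {t}))) e)
      -- For fixed `b` the quintic at `point b t` unfolds to `conic` at `t`, with coefficients the
      -- values of the three polynomials at `⟦ b ⟧`.
      plane-residue (λ b → conic-residue _ _ _)

    normalForm↔X̃₅⁽³⁾ : Inverse normalFormSetoid (X̃₅⁽³⁾ P₃ Q₃ Q₄)
    normalForm↔X̃₅⁽³⁾ = bijective⇒inverse normalFormSetoid (X̃₅⁽³⁾ P₃ Q₃ Q₄)
      (λ ((b , t) , e) → (point b t , point∉Z b t) , e)
      (λ (b≈ , t≈) → ≋⇒∼ (point-cong b≈ t≈))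
      point-injective
      (λ ((x , x∉Z) , fx≈0) →
         let b , t , pt∼x = point-surjective x x∉Z
         -- The normal form lies in the orbit of the zero `x`, so by bihomogeneity it is a zero as
         -- well.
         in ((b , t) , vanish-resp-∼ (∼-sym pt∼x) fx≈0) , pt∼x)

    X̃₅⁽³⁾-residue : HasResidue (X̃₅⁽³⁾ P₃ Q₃ Q₄) 1
    X̃₅⁽³⁾-residue = residue-resp-↔ normalForm↔X̃₅⁽³⁾ normalForm-residue

mainTheorem2 : ∀ {c ℓ₁ ℓ₂} (F : HeytingField c ℓ₁ ℓ₂) (q : ℕ) →
    let open OverField F in
    HasCardinality fieldSetoid q →
    (P₃ Q₃ Q₄ : Polynomial 3) →
    IsHomogeneous 3 P₃ → IsHomogeneous 3 Q₃ → IsHomogeneous 4 Q₄ →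
    ¬ (IsZero P₃ × IsZero Q₃ × IsZero Q₄) →
    ∃[ N ] HasCardinality (X̃₅⁽³⁾ P₃ Q₃ Q₄) N × N ≡ 1 mod q
mainTheorem2 F q #F P₃ Q₃ Q₄ hP₃ hQ₃ hQ₄ _ =
  let k , #X = X̃₅⁽³⁾-residue F q #F P₃ Q₃ Q₄ hP₃ hQ₃ hQ₄
  in 1 +ℕ k *ℕ q , #X , Counting.residue⇒mod q 1 k
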